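{- For every integer $n\ge 0$, $$|RAI_{2n}(4321)|=M_n,$$ where $M_n$ is the $n$-th Motzkin number.
   Context: Let $S_n$ be the set of permutations $\pi=\pi_1\ldots\pi_n$ of $\{1,\ldots,n\}$ (for $n=0$, only the empty permutation). A permutation is reverse alternating if, for all $1\le i\le n-1$, $\pi_i>\pi_{i+1}$ if and only if $i$ is odd. $RAI_n$ is the set of reverse alternating involutions ($\pi=\pi^{ -1}$) in $S_n$. A permutation $\pi\in S_n$ avoids the pattern $\tau\in S_k$ if there are no indices $i_1<\cdots<i_k$ such that $\pi_{i_1}\ldots\pi_{i_k}$ is order-isomorphic to $\tau$; $RAI_n(\tau)$ is the set of elements of $RAI_n$ avoiding $\tau$. The Motzkin number $M_n$ is the number of Motzkin paths of length $n$, i.e. lattice paths from $(0,0)$ to $(n,0)$ with steps $U=(1,1)$, $D=(1,-1)$, $H=(1,0)$ that stay weakly above the $x$-axis (so $M_0=M_1=1$, $M_2=2$, $M_3=4$). -}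

module Defs where

open import Level using (Level)
open import Data.Fin using (Fin; zero; suc; toℕ; fromℕ; _<_)
open import Data.Fin.Permutation using (Permutation′; _⟨$⟩ʳ_; _≈_; flip; reverse)
open import Data.Fin.Properties using (all?; ≡-setoid)
open import Data.Integer using (ℤ; 0ℤ; 1ℤ; -1ℤ; _+_; _≤_; _≤?_; _≟_)
open import Data.List using (List; []; _∷_; [_]; length; filter; cartesianProductWith)
open import Data.Nat using (ℕ; zero; suc)
open import Data.Nat.Divisibility using (_∣_)
open import Data.Product using (Σ-syntax; _×_)
open import Data.Vec using (Vec; []; _∷_)
open import Function.Bundles using (Inverse; _⇔_)
open import Relation.Binary.Bundles using (Setoid)
open import Relation.Binary.PropositionalEquality using (_≡_; refl; sym; trans)
open import Relation.Nullary using (¬_; Dec; _×-dec_)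

-- Indices and values of a permutation are counted from 0 here, so `i : Fin n`
-- is position `suc (toℕ i)` of the one-line notation π₁…πₙ.

IsReverseAlternating : ∀ {n} → Permutation′ n → Set
IsReverseAlternating {n} π =
  (i j : Fin n) → toℕ j ≡ suc (toℕ i) →
  (π ⟨$⟩ʳ j < π ⟨$⟩ʳ i) ⇔ (¬ 2 ∣ suc (toℕ i))

IsInvolution : ∀ {n} → Permutation′ n → Set
IsInvolution π = π ≈ flip π

Contains : ∀ {n k} → Permutation′ n → Permutation′ k → Set
Contains {n} {k} π τ =
  Σ[ f ∈ (Fin k → Fin n) ]
    (∀ a b → a < b → f a < f b) ×
    (∀ a b → (τ ⟨$⟩ʳ a < τ ⟨$⟩ʳ b) ⇔ (π ⟨$⟩ʳ f a < π ⟨$⟩ʳ f b))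

Avoids : ∀ {n k} → Permutation′ n → Permutation′ k → Set
Avoids π τ = ¬ Contains π τ

[4321] : Permutation′ 4
[4321] = reverse

record RAI (n : ℕ) {k : ℕ} (τ : Permutation′ k) : Set where
  field
    perm                 : Permutation′ n
    isReverseAlternating : IsReverseAlternating perm
    isInvolution         : IsInvolution perm
    avoids               : Avoids perm τ

open RAI

-- Elements are identified when their permutations agree pointwise; the proofs
-- of the defining properties are ignored.
RAI-setoid : (n : ℕ) {k : ℕ} (τ : Permutation′ k) → Setoid _ _
RAI-setoid n τ = record
  { Carrier       = RAI n τ
  ; _≈_           = λ x y → perm x ≈ perm y
  ; isEquivalence = record
    { refl  = λ _ → refl
    ; sym   = λ p i → sym (p i)
    ; trans = λ p q i → trans (p i) (q i)
    }
  }

HasCardinality : ∀ {a ℓ : Level} → Setoid a ℓ → ℕ → Set _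
HasCardinality S m = Inverse S (≡-setoid m)

data Step : Set where
  U D H : Step

rise : Step → ℤ
rise U = 1ℤ
rise D = -1ℤ
rise H = 0ℤ

-- The ordinate after the first i steps.
height : ∀ {n} → Vec Step n → Fin (suc n) → ℤ
height p       zero    = 0ℤ
height (s ∷ p) (suc i) = rise s + height p i

IsMotzkinPath : ∀ {n} → Vec Step n → Set
IsMotzkinPath {n} p = (∀ i → 0ℤ ≤ height p i) × height p (fromℕ n) ≡ 0ℤ

isMotzkinPath? : ∀ {n} (p : Vec Step n) → Dec (IsMotzkinPath p)
isMotzkinPath? {n} p =
  all? (λ i → 0ℤ ≤? height p i) ×-dec (height p (fromℕ n) ≟ 0ℤ)

-- All 3ⁿ words of length n, each listed exactly once.
words : ∀ n → List (Vec Step n)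
words zero    = [ [] ]
words (suc n) = cartesianProductWith _∷_ (U ∷ D ∷ H ∷ []) (words n)

motzkin : ℕ → ℕ
motzkin n = length (filter isMotzkinPath? (words n))

{-# OPTIONS --safe #-}

-- Give position i of an involution π the letter U, H or D according as
-- i < π i, i = π i or i > π i. Then π avoids 4321 iff no two of its arcs are
-- nested, and a nonnesting involution is determined by its word: the arcs join
-- the r-th U to the r-th D. For such π, position i is a descent exactly when
-- its letter and the next one form UH, UD or HD. Hence π in S_2n is reverse
-- alternating iff its word is cut into n such pairs, the ascents between
-- consecutive pairs being automatic. Reading the pairs as U, H, D, their total
-- rises, gives a Motzkin path of length n, and every Motzkin path arises.
module Submission where

open import Defs
open import Data.Bool using (true; false; if_then_else_; T)
open import Data.Fin as Fin using (Fin; zero; suc; toℕ; fromℕ; fromℕ<)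
open import Data.Fin.Induction using (<-wellFounded)
open import Data.Fin.Patterns using (0F; 1F; 2F; 3F)
open import Data.Fin.Permutation using (Permutation′; _⟨$⟩ʳ_; permutation; inverseʳ)
open import Data.Fin.Properties using (toℕ<n; toℕ-injective; toℕ-fromℕ; toℕ-fromℕ<)
open import Data.Integer as ℤ using (0ℤ; _⊖_)
import Data.Integer.Properties as ℤ
open import Data.List as List using (List; _∷_; [])
open import Data.List.Membership.Propositional using (_∈_)
open import Data.List.Membership.Propositional.Properties
  using (∈-cartesianProductWith⁺; ∈-filter⁺; ∈-filter⁻; ∈-lookup)
open import Data.List.Relation.Unary.All as All using ([]; _∷_)
open import Data.List.Relation.Unary.Any as Any using (here; there)
open import Data.List.Relation.Unary.Any.Properties using (lookup-index)
open import Data.List.Relation.Unary.AllPairs using ([]; _∷_)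
open import Data.List.Relation.Unary.Unique.Propositional using (Unique)
import Data.List.Relation.Unary.Unique.Propositional.Properties as Unique
open import Data.Nat
open import Data.Nat.Divisibility using (_∣_; divides)
open import Data.Nat.Properties
open import Data.Product using (Σ-syntax; _×_; _,_; proj₁; proj₂)
open import Data.Sum using (_⊎_; inj₁; inj₂)
open import Data.Vec using (Vec; []; _∷_)
import Data.Vec.Properties as Vec
open import Function using (_∘_; _⇔_; mk⇔; Equivalence; Inverse)
open import Function.Construct.Composition using () renaming (inverse to _∘ᵢ_)
open import Function.Properties.Bijection using (Bijection⇒Inverse)
open import Induction.WellFounded using (Acc; acc)
open import Level using (0ℓ)
open import Relation.Binary.Bundles using (Setoid)
open import Relation.Binary.Definitions using (tri<; tri≈; tri>)
open import Relation.Binary.PropositionalEquality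
open import Relation.Nullary using (¬_; yes; no; contradiction)
open import Algebra.Properties.CommutativeMonoid.Sum +-0-commutativeMonoid
  using (sum; sum-cong-≗; sum-permute)

open RAI

private
  variable
    m n i j k l : ℕ
    s t : Step
    v w : ℕ → Step

-- Words and the letter of a position

Compares : Step → ℕ → ℕ → Set
Compares U i j = i < j
Compares D i j = j < i
Compares H i j = i ≡ j

letter : ℕ → ℕ → Step
letter zero    zero    = H
letter zero    (suc _) = U
letter (suc _) zero    = D
letter (suc i) (suc j) = letter i j

letter-compares : ∀ i j → Compares (letter i j) i j
letter-compares zero    zero    = refl
letter-compares zero    (suc _) = z<s
letter-compares (suc _) zero    = z<s
letter-compares (suc i) (suc j) with letter i j | letter-compares i j
... | U | i<j = s<s i<j
... | D | j<i = s<s j<i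
... | H | i≡j = cong suc i≡j

compares-unique : ∀ s t → Compares s i j → Compares t i j → s ≡ t
compares-unique U U _ _ = refl
compares-unique D D _ _ = refl
compares-unique H H _ _ = refl
compares-unique U D p q = contradiction q (<⇒≯ p)
compares-unique U H p q = contradiction q (<⇒≢ p)
compares-unique D U p q = contradiction q (<⇒≯ p)
compares-unique D H p q = contradiction (sym q) (<⇒≢ p)
compares-unique H U p q = contradiction p (<⇒≢ q)
compares-unique H D p q = contradiction (sym p) (<⇒≢ q)

letter-unique : ∀ s → Compares s i j → letter i j ≡ s
letter-unique {i} {j} s c = compares-unique (letter i j) s (letter-compares i j) c

-- Words are functions on all of `ℕ`, so shifting and counting carry no bounds; the `H` past the end
-- is a filler, and words are compared only through `AgreeBelow`.
toWord : (Fin m → Step) → ℕ → Step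
toWord {zero}  _ _       = H
toWord {suc m} a zero    = a zero
toWord {suc m} a (suc k) = toWord (a ∘ suc) k

toWord-toℕ : (a : Fin m → Step) (i : Fin m) → toWord a (toℕ i) ≡ a i
toWord-toℕ a zero    = refl
toWord-toℕ a (suc i) = toWord-toℕ (a ∘ suc) i

AgreeBelow : ℕ → (ℕ → Step) → (ℕ → Step) → Set
AgreeBelow m v w = ∀ {k} → k < m → v k ≡ w k

agreeBelow : (∀ (i : Fin m) → v (toℕ i) ≡ w (toℕ i)) → AgreeBelow m v w
agreeBelow {v = v} {w = w} h k<m =
  subst (λ k → v k ≡ w k) (toℕ-fromℕ< k<m) (h (fromℕ< k<m))

-- Counting letters

indicator : Step → Step → ℕ
indicator U U = 1
indicator D D = 1
indicator H H = 1
indicator _ _ = 0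

indicator-refl : ∀ s → indicator s s ≡ 1
indicator-refl U = refl
indicator-refl D = refl
indicator-refl H = refl

indicator-cases : ∀ s t → t ≡ s ⊎ indicator s t ≡ 0
indicator-cases U U = inj₁ refl
indicator-cases U D = inj₂ refl
indicator-cases U H = inj₂ refl
indicator-cases D U = inj₂ refl
indicator-cases D D = inj₁ refl
indicator-cases D H = inj₂ refl
indicator-cases H U = inj₂ refl
indicator-cases H D = inj₂ refl
indicator-cases H H = inj₁ refl

-- Position `k` itself is left out, so for a letter `s` at `k` this is its rank among the letters
-- `s`, starting from 0.
count : Step → (ℕ → Step) → ℕ → ℕ
count s w zero    = 0
count s w (suc k) = indicator s (w k) + count s w k

count-hit : w k ≡ s → count s w (suc k) ≡ suc (count s w k)
count-hit {w} {k} refl = cong (_+ count (w k) w k) (indicator-refl (w k))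

-- `count` splits off the last letter, whereas `sum` and `expand` recurse on the front; this
-- mediates between the two.
count-front : ∀ s w k → count s w (suc k) ≡ indicator s (w 0) + count s (w ∘ suc) k
count-front s w zero    = refl
count-front s w (suc k) = begin
  indicator s (w (suc k)) + count s w (suc k)
    ≡⟨ cong (indicator s (w (suc k)) +_) (count-front s w k) ⟩
  indicator s (w (suc k)) + (indicator s (w 0) + count s (w ∘ suc) k)
    ≡⟨ x∙yz≈y∙xz (indicator s (w (suc k))) (indicator s (w 0)) (count s (w ∘ suc) k) ⟩
  indicator s (w 0) + count s (w ∘ suc) (suc k) ∎
  where
  open ≡-Reasoning
  open import Algebra.Properties.CommutativeSemigroup +-commutativeSemigroup using (x∙yz≈y∙xz)

count-cong : ∀ s k → AgreeBelow k v w → count s v k ≡ count s w k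
count-cong s zero    h = refl
count-cong s (suc k) h =
  cong₂ _+_ (cong (indicator s) (h ≤-refl)) (count-cong s k (h ∘ m<n⇒m<1+n))

count-mono : ∀ s w → k ≤ l → count s w k ≤ count s w l
count-mono s w k≤l = go (≤⇒≤′ k≤l)
  where
  go : k ≤′ l → count s w k ≤ count s w l
  go ≤′-refl       = ≤-refl
  go (≤′-step k≤l) = ≤-trans (go k≤l) (m≤n+m _ _)

count-strict : w k ≡ s → k < l → count s w k < count s w l
count-strict {w} {s = s} {l = l} hit k<l = subst (_≤ count s w l) (count-hit {w} hit) (count-mono s w k<l)

count-injective : w k ≡ s → w l ≡ s → count s w k ≡ count s w l → k ≡ l
count-injective {w} {k} {s} {l} hk hl eq with <-cmp k l
... | tri< k<l _ _ = contradiction eq (<⇒≢ (count-strict {w} hk k<l))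
... | tri≈ _ k≡l _ = k≡l
... | tri> _ _ l<k = contradiction (sym eq) (<⇒≢ (count-strict {w} hl l<k))

-- The count grows by at most one per position, so the shortest prefix with more than `l` letters
-- `s` ends in an `s` of rank exactly `l`.
count-find : ∀ s w m → l < count s w m → Σ[ k ∈ ℕ ] k < m × w k ≡ s × count s w k ≡ l
count-find {l} s w (suc m) l< with l <? count s w m
... | yes l<m = let k , k<m , hit , eq = count-find s w m l<m in k , m<n⇒m<1+n k<m , hit , eq
... | no  l≮m with indicator-cases s (w m)
...   | inj₁ hit = m , ≤-refl , hit ,
        ≤-antisym (≮⇒≥ l≮m) (s≤s⁻¹ (subst (l <_) (count-hit {w} hit) l<))
...   | inj₂ miss = contradiction (subst (λ x → l < x + count s w m) miss l<) l≮m

record Ballot (m : ℕ) (w : ℕ → Step) : Set where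
  field
    prefix : ∀ {k} → k ≤ m → count D w k ≤ count U w k
    total  : count D w m ≡ count U w m

ballot-cong : AgreeBelow m v w → Ballot m v → Ballot m w
ballot-cong {m} {v} {w} v≈w b = record
  { prefix = λ {k} k≤m → subst₂ _≤_ (same D k≤m) (same U k≤m) (prefix k≤m)
  ; total  = trans (sym (same D ≤-refl)) (trans total (same U ≤-refl))
  }
  where
  open Ballot b
  same : ∀ s {k} → k ≤ m → count s v k ≡ count s w k
  same s {k} k≤m = count-cong s k (λ l<k → v≈w (<-≤-trans l<k k≤m))

-- Nonnesting involutions

Involutive : (Fin m → Fin m) → Set
Involutive f = ∀ i → f (f i) ≡ i

NonNesting : (Fin m → Fin m) → Set
NonNesting f = ∀ i j → i Fin.< j → j Fin.< f j → ¬ (f j Fin.< f i)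

HasWord : (ℕ → Step) → (Fin m → Fin m) → Set
HasWord w f = ∀ i → Compares (w (toℕ i)) (toℕ i) (toℕ (f i))

wordOf : (Fin m → Fin m) → ℕ → Step
wordOf f = toWord (λ i → letter (toℕ i) (toℕ (f i)))

wordOf-toℕ : (f : Fin m → Fin m) (i : Fin m) →
             wordOf f (toℕ i) ≡ letter (toℕ i) (toℕ (f i))
wordOf-toℕ f = toWord-toℕ (λ i → letter (toℕ i) (toℕ (f i)))

wordOf-hasWord : (f : Fin m → Fin m) → HasWord (wordOf f) f
wordOf-hasWord f i =
  subst (λ s → Compares s (toℕ i) (toℕ (f i)))
    (sym (wordOf-toℕ f i)) (letter-compares (toℕ i) (toℕ (f i)))

hasWord-agree : {f : Fin m → Fin m} → AgreeBelow m v w → HasWord v f → HasWord w f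
hasWord-agree v≈w h i = subst (λ s → Compares s _ _) (v≈w (toℕ<n i)) (h i)

hasWord-wordOf : {f : Fin m → Fin m} → HasWord w f → AgreeBelow m (wordOf f) w
hasWord-wordOf {f = f} h =
  agreeBelow (λ i → trans (wordOf-toℕ f i) (letter-unique _ (h i)))

letterAt : ∀ w {f : Fin m → Fin m} → HasWord w f → ∀ i s →
           Compares s (toℕ i) (toℕ (f i)) → w (toℕ i) ≡ s
letterAt w h i s c = compares-unique (w (toℕ i)) s (h i) c

compareAt : ∀ w {f : Fin m → Fin m} → HasWord w f → ∀ i {s} →
            w (toℕ i) ≡ s → Compares s (toℕ i) (toℕ (f i))
compareAt w h i refl = h i

opener-image : ∀ w {f : Fin m → Fin m} → Involutive f → HasWord w f → ∀ i →
               w (toℕ i) ≡ U → w (toℕ (f i)) ≡ D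
opener-image w {f} ff h i wi =
  letterAt w h (f i) D (subst (Fin._< f i) (sym (ff i)) (compareAt w h i wi))

closer-image : ∀ w {f : Fin m → Fin m} → Involutive f → HasWord w f → ∀ i →
               w (toℕ i) ≡ D → w (toℕ (f i)) ≡ U
closer-image w {f} ff h i wi =
  letterAt w h (f i) U (subst (f i Fin.<_) (sym (ff i)) (compareAt w h i wi))

module _ {m : ℕ} {w : ℕ → Step} where

  AgreeOnOpeners : Fin m → (f g : Fin m → Fin m) → Set
  AgreeOnOpeners i f g = ∀ {j} → j Fin.< i → w (toℕ j) ≡ U → f j ≡ g j

  -- If f i < g i, the closer f i has a g-partner j ≠ i: j < i contradicts the
  -- agreement below i, and j > i nests the g-arc of j under that of i.
  opener-≮ : {f g : Fin m → Fin m} → Involutive f → Involutive g → NonNesting g →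
             HasWord w f → HasWord w g →
             ∀ i → AgreeOnOpeners i f g → w (toℕ i) ≡ U → ¬ (f i Fin.< g i)
  opener-≮ {f} {g} ff gg ng hf hg i agree wi fi<gi
    with <-cmp (toℕ (g (f i))) (toℕ i)
  ... | tri< j<i _ _ = <⇒≢ j<i (cong toℕ (begin
    g (f i)         ≡⟨ ff (g (f i)) ⟨
    f (f (g (f i))) ≡⟨ cong f (agree j<i (closer-image w gg hg (f i) wfi)) ⟩
    f (g (g (f i))) ≡⟨ cong f (gg (f i)) ⟩
    f (f i)         ≡⟨ ff i ⟩
    i               ∎))
    where
    open ≡-Reasoning
    wfi = opener-image w ff hf i wi
  ... | tri≈ _ j≡i _ = <⇒≢ fi<gi (cong toℕ (trans (sym (gg (f i))) (cong g (toℕ-injective j≡i))))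
  ... | tri> _ _ i<j =
    ng i (g (f i)) i<j
       (subst (g (f i) Fin.<_) (sym (gg (f i))) (compareAt w hg (f i) wfi))
       (subst (Fin._< g i) (sym (gg (f i))) fi<gi)
    where
    wfi = opener-image w ff hf i wi

  module _ {f g : Fin m → Fin m} (ff : Involutive f) (gg : Involutive g)
           (nf : NonNesting f) (ng : NonNesting g)
           (hf : HasWord w f) (hg : HasWord w g) where

    -- Strong induction on the opener: `opener-≮`, applied in both directions, excludes either image
    -- being the smaller one.
    openers-agree : ∀ i → Acc Fin._<_ i → w (toℕ i) ≡ U → f i ≡ g i
    openers-agree i (acc rs) wi with <-cmp (toℕ (f i)) (toℕ (g i))
    ... | tri< fi<gi _ _ = contradiction fi<gi
          (opener-≮ ff gg ng hf hg i (λ j<i → openers-agree _ (rs j<i)) wi)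
    ... | tri≈ _ fi≡gi _ = toℕ-injective fi≡gi
    ... | tri> _ _ gi<fi = contradiction gi<fi
          (opener-≮ gg ff nf hg hf i (λ j<i wj → sym (openers-agree _ (rs j<i) wj)) wi)

    nonnesting-unique : ∀ i → f i ≡ g i
    nonnesting-unique i with w (toℕ i) in wi | hf i | hg i
    ... | U | _    | _    = openers-agree i (<-wellFounded i) wi
    ... | H | i≡fi | i≡gi = toℕ-injective (trans (sym i≡fi) i≡gi)
    -- A closer is treated through its `f`-partner, an opener, where `f` and `g` already agree.
    ... | D | _    | _    = begin
      f i         ≡⟨ gg (f i) ⟨
      g (g (f i)) ≡⟨ cong g (openers-agree (f i) (<-wellFounded _) opener) ⟨
      g (f (f i)) ≡⟨ cong g (ff i) ⟩
      g i         ∎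
      where
      open ≡-Reasoning
      opener : w (toℕ (f i)) ≡ U
      opener = closer-image w ff hf i wi

-- The word of an involution is a ballot word

-- Truncating the summands turns a prefix count into a sum over all of `Fin m`, which can be
-- reindexed by a permutation.
cut : ℕ → ℕ → ℕ → ℕ
cut k i x = if i <ᵇ k then x else 0

cut-below : i < k → ∀ x → cut k i x ≡ x
cut-below {i} {k} i<k x with i <ᵇ k | <⇒<ᵇ i<k
... | true | _ = refl

sum-cut : ∀ s (w : ℕ → Step) → k ≤ m →
          sum (λ (i : Fin m) → cut k (toℕ i) (indicator s (w (toℕ i)))) ≡ count s w k
sum-cut {m = zero}        s w z≤n = refl
sum-cut {m = suc m}       s w z≤n = sum-cut {m = m} s (w ∘ suc) z≤n
sum-cut {k = suc k} s w (s≤s k≤m) =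
  trans (cong (indicator s (w 0) +_) (sum-cut s (w ∘ suc) k≤m)) (sym (count-front s w k))

sum-mono : {a b : Fin m → ℕ} → (∀ i → a i ≤ b i) → sum a ≤ sum b
sum-mono {zero}  h = z≤n
sum-mono {suc m} h = +-mono-≤ (h zero) (sum-mono (h ∘ suc))

indicator-swap : ∀ i j → indicator D (letter j i) ≡ indicator U (letter i j)
indicator-swap zero    zero    = refl
indicator-swap zero    (suc j) = refl
indicator-swap (suc i) zero    = refl
indicator-swap (suc i) (suc j) = indicator-swap i j

-- Only an arc with `i < j` contributes, and if its closer lies below `k`, so does its opener.
cut-opener : ∀ k i j → cut k j (indicator U (letter i j)) ≤ cut k i (indicator U (letter i j))
cut-opener k i j with letter i j in eq
cut-opener k i j | D with j <ᵇ k
... | true  = z≤n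
... | false = z≤n
cut-opener k i j | H with j <ᵇ k
... | true  = z≤n
... | false = z≤n
cut-opener k i j | U with j <ᵇ k in j<ᵇk
... | false = z≤n
... | true  = ≤-reflexive (sym (cut-below i<k 1))
  where
  i<k : i < k
  i<k = <-trans (subst (λ s → Compares s i j) eq (letter-compares i j))
                (<ᵇ⇒< j k (subst T (sym j<ᵇk) _))

module _ (π : Permutation′ m) (ππ : Involutive (π ⟨$⟩ʳ_)) where

  private
    f : Fin m → Fin m
    f = π ⟨$⟩ʳ_

    opens : Fin m → ℕ
    opens i = indicator U (letter (toℕ i) (toℕ (f i)))

  count-wordOf : ∀ s → k ≤ m →
    count s (wordOf f) k ≡ sum (λ i → cut k (toℕ i) (indicator s (letter (toℕ i) (toℕ (f i)))))
  count-wordOf {k} s k≤m = trans (sym (sum-cut s (wordOf f) k≤m))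
    (sum-cong-≗ (λ i → cong (cut k (toℕ i) ∘ indicator s) (wordOf-toℕ f i)))

  -- Reindexing along `π` charges every closer to its opener.
  count-closers : k ≤ m → count D (wordOf f) k ≡ sum (λ i → cut k (toℕ (f i)) (opens i))
  count-closers {k} k≤m = begin
    count D (wordOf f) k
      ≡⟨ count-wordOf D k≤m ⟩
    sum (λ i → cut k (toℕ i) (indicator D (letter (toℕ i) (toℕ (f i)))))
      ≡⟨ sum-permute _ π ⟩
    sum (λ i → cut k (toℕ (f i)) (indicator D (letter (toℕ (f i)) (toℕ (f (f i))))))
      ≡⟨ sum-cong-≗ (λ i → cong (cut k (toℕ (f i)))
           (trans (cong (indicator D ∘ letter (toℕ (f i)) ∘ toℕ) (ππ i))
                  (indicator-swap (toℕ i) (toℕ (f i))))) ⟩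
    sum (λ i → cut k (toℕ (f i)) (opens i)) ∎
    where open ≡-Reasoning

  -- Both counts become sums over the openers, cut at `f i` for `D` and at `i` for `U`, and are
  -- compared term by term; at `k = m` nothing is cut off.
  wordOf-ballot : Ballot m (wordOf f)
  wordOf-ballot = record
    { prefix = λ {k} k≤m → subst₂ _≤_ (sym (count-closers k≤m)) (sym (count-wordOf U k≤m))
        (sum-mono (λ i → cut-opener k (toℕ i) (toℕ (f i))))
    ; total  = begin
        count D (wordOf f) m                    ≡⟨ count-closers ≤-refl ⟩
        sum (λ i → cut m (toℕ (f i)) (opens i)) ≡⟨ sum-cong-≗ (λ i → trans
                                                     (cut-below (toℕ<n (f i)) (opens i))
                                                     (sym (cut-below (toℕ<n i) (opens i)))) ⟩
        sum (λ i → cut m (toℕ i) (opens i))     ≡⟨ count-wordOf U ≤-refl ⟨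
        count U (wordOf f) m                    ∎
    }
    where open ≡-Reasoning

-- The nonnesting involution of a ballot word

-- The matching as a relation on ranks is symmetric and functional for every word; the ballot
-- condition serves to find partners and to put openers before closers.
data Arc (w : ℕ → Step) (i j : ℕ) : Set where
  opening : w i ≡ U → w j ≡ D → count U w i ≡ count D w j → Arc w i j
  closing : w i ≡ D → w j ≡ U → count D w i ≡ count U w j → Arc w i j
  fixed   : w i ≡ H → i ≡ j → Arc w i j

arc-sym : Arc w i j → Arc w j i
arc-sym (opening wi wj eq) = closing wj wi (sym eq)
arc-sym (closing wi wj eq) = opening wj wi (sym eq)
arc-sym (fixed wi refl)    = fixed wi refl

arc-functional : ∀ w {i j l} → Arc w i j → Arc w i l → j ≡ l
arc-functional w (opening _ wj p) (opening _ wl q) = count-injective {w} wj wl (trans (sym p) q)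
arc-functional w (closing _ wj p) (closing _ wl q) = count-injective {w} wj wl (trans (sym p) q)
arc-functional w (fixed _ refl) (fixed _ refl) = refl
arc-functional w (opening wi _ _) (closing wi′ _ _) = contradiction (trans (sym wi) wi′) λ ()
arc-functional w (opening wi _ _) (fixed wi′ _) = contradiction (trans (sym wi) wi′) λ ()
arc-functional w (closing wi _ _) (opening wi′ _ _) = contradiction (trans (sym wi) wi′) λ ()
arc-functional w (closing wi _ _) (fixed wi′ _) = contradiction (trans (sym wi) wi′) λ ()
arc-functional w (fixed wi _) (opening wi′ _ _) = contradiction (trans (sym wi) wi′) λ ()
arc-functional w (fixed wi _) (closing wi′ _ _) = contradiction (trans (sym wi) wi′) λ ()

module FromBallot {m : ℕ} {w : ℕ → Step} (b : Ballot m w) where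
  open Ballot b

  partner : i < m → Σ[ j ∈ ℕ ] j < m × Arc w i j
  partner {i} i<m with w i in wi
  ... | H = i , i<m , fixed wi refl
  -- The rank of this `U` is below the number of `U`s, which by `total` is the number of `D`s, so
  -- some `D` has the same rank.
  ... | U = let j , j<m , wj , eq = count-find D w m
                  (subst (count U w i <_) (sym total) (count-strict {w} wi i<m))
            in j , j<m , opening wi wj (sym eq)
  ... | D = let j , j<m , wj , eq = count-find U w m
                  (subst (count D w i <_) total (count-strict {w} wi i<m))
            in j , j<m , closing wi wj (sym eq)

  -- If `j < i`, the ballot condition just after `j` yields more than `count D w j` letters `U`
  -- before `i`, against the equality of ranks.
  opener<closer : i < m → j < m → w i ≡ U → w j ≡ D → count U w i ≡ count D w j → i < j
  opener<closer {i} {j} i<m j<m wi wj eq with <-cmp i j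
  ... | tri< i<j _ _ = i<j
  ... | tri≈ _ refl _ = contradiction (trans (sym wi) wj) λ ()
  ... | tri> _ _ j<i = contradiction eq (>⇒≢ (begin-strict
    count D w j       <⟨ count-strict {w} wj ≤-refl ⟩
    count D w (suc j) ≤⟨ prefix j<m ⟩
    count U w (suc j) ≤⟨ count-mono U w j<i ⟩
    count U w i       ∎))
    where open ≤-Reasoning

  arc-compares : i < m → j < m → Arc w i j → Compares (w i) i j
  arc-compares i<m j<m (opening wi wj eq) rewrite wi = opener<closer i<m j<m wi wj eq
  arc-compares i<m j<m (closing wi wj eq) rewrite wi = opener<closer j<m i<m wj wi (sym eq)
  arc-compares i<m j<m (fixed wi i≡j)     rewrite wi = i≡j

  match : Fin m → Fin m
  match i = fromℕ< (proj₁ (proj₂ (partner (toℕ<n i))))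

  match-arc : ∀ i → Arc w (toℕ i) (toℕ (match i))
  match-arc i = let _ , j<m , arc = partner (toℕ<n i)
                in subst (Arc w (toℕ i)) (sym (toℕ-fromℕ< j<m)) arc

  match-involutive : Involutive match
  match-involutive i =
    toℕ-injective (arc-functional w (match-arc (match i)) (arc-sym (match-arc i)))

  match-hasWord : HasWord w match
  match-hasWord i = arc-compares (toℕ<n i) (toℕ<n (match i)) (match-arc i)

  opener-count : ∀ i → i Fin.< match i → count U w (toℕ i) ≡ count D w (toℕ (match i))
  opener-count i i<mi with match-arc i | letterAt w match-hasWord i U i<mi
  ... | opening _ _ eq | _  = eq
  ... | closing wi _ _ | wi′ = contradiction (trans (sym wi) wi′) λ ()
  ... | fixed wi _     | wi′ = contradiction (trans (sym wi) wi′) λ ()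

  -- Ranks increase along the openers and are passed on to the closers, so arcs close in the order
  -- in which they open.
  match-nonnesting : NonNesting match
  match-nonnesting i j i<j j<mj mj<mi = <⇒≱ (begin-strict
    count D w (toℕ (match i)) ≡⟨ opener-count i i<mi ⟨
    count U w (toℕ i)         <⟨ count-strict {w} (letterAt w match-hasWord i U i<mi) i<j ⟩
    count U w (toℕ j)         ≡⟨ opener-count j j<mj ⟩
    count D w (toℕ (match j)) ∎) (count-mono D w (<⇒≤ mj<mi))
    where
    open ≤-Reasoning
    i<mi = <-trans i<j (<-trans j<mj mj<mi)

  matching : Permutation′ m
  matching = permutation match match match-involutive match-involutive

-- Pairing consecutive letters

-- The pairs UH, UD, HD are recorded by their total rise.
first second : Step → Step
first U = U
first H = U
first D = H
second U = H
second H = D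
second D = D

-- The last clause gives `HD` its value; the six pairs that `Pairs` excludes also land there, with
-- an arbitrary value.
code : Step → Step → Step
code U H = U
code U D = H
code _ _ = D

code-first-second : ∀ c → code (first c) (second c) ≡ c
code-first-second U = refl
code-first-second D = refl
code-first-second H = refl

Paired : Step → Step → Set
Paired s t = Σ[ c ∈ Step ] s ≡ first c × t ≡ second c

Pairs : ℕ → (ℕ → Step) → Set
Pairs n w = ∀ k → k < n → Paired (w (k * 2)) (w (suc (k * 2)))

expand : Vec Step n → ℕ → Step
expand []      _             = H
expand (c ∷ p) zero          = first c
expand (c ∷ p) (suc zero)    = second c
expand (c ∷ p) (suc (suc k)) = expand p k

compress : ∀ n → (ℕ → Step) → Vec Step n
compress zero    w = []
compress (suc n) w = code (w 0) (w 1) ∷ compress n (λ k → w (suc (suc k)))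

expand-pairs : (p : Vec Step n) → Pairs n (expand p)
expand-pairs (c ∷ p) zero    _         = c , refl , refl
expand-pairs (c ∷ p) (suc k) (s≤s k<n) = expand-pairs p k k<n

compress-expand : (p : Vec Step n) → compress n (expand p) ≡ p
compress-expand []      = refl
compress-expand (c ∷ p) = cong₂ _∷_ (code-first-second c) (compress-expand p)

compress-cong : ∀ n → AgreeBelow (n * 2) v w → compress n v ≡ compress n w
compress-cong zero    h = refl
compress-cong (suc n) h =
  cong₂ _∷_ (cong₂ code (h z<s) (h (s<s z<s))) (compress-cong n (h ∘ s<s ∘ s<s))

expand-compress : ∀ n → Pairs n w → AgreeBelow (n * 2) w (expand (compress n w))
expand-compress (suc n) ps {zero} _ with ps 0 z<s
... | c , eq₁ , eq₂ rewrite eq₁ | eq₂ = sym (cong first (code-first-second c))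
expand-compress (suc n) ps {suc zero} _ with ps 0 z<s
... | c , eq₁ , eq₂ rewrite eq₁ | eq₂ = sym (cong second (code-first-second c))
expand-compress (suc n) ps {suc (suc k)} (s≤s (s≤s k<)) =
  expand-compress n (λ k k<n → ps (suc k) (s<s k<n)) k<

half : ∀ k → Σ[ j ∈ ℕ ] (k ≡ j * 2 ⊎ k ≡ suc (j * 2))
half zero = 0 , inj₁ refl
half (suc k) with half k
... | j , inj₁ eq = j , inj₂ (cong suc eq)
... | j , inj₂ eq = suc j , inj₁ (cong suc eq)

-- Heights and ballot words

-- One step of the path is two letters of the word, and its rise is their number of `U`s minus their
-- number of `D`s; for `H` these cancel.
rise-⊖ : ∀ c a b → rise c ℤ.+ (a ⊖ b) ≡
         (indicator U (first c) + (indicator U (second c) + a)) ⊖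
         (indicator D (first c) + (indicator D (second c) + b))
rise-⊖ U a b = ℤ.distribʳ-⊖-+-pos 1 a b
rise-⊖ D a b = ℤ.distribʳ-⊖-+-neg 0 a b
rise-⊖ H a b = trans (ℤ.+-identityˡ (a ⊖ b)) (sym (ℤ.[1+m]⊖[1+n]≡m⊖n a b))

count-expand-∷ : ∀ s c (p : Vec Step n) k → count s (expand (c ∷ p)) (suc (suc k)) ≡
                 indicator s (first c) + (indicator s (second c) + count s (expand p) k)
count-expand-∷ s c p k = trans (count-front s (expand (c ∷ p)) (suc k))
  (cong (indicator s (first c) +_) (count-front s (expand (c ∷ p) ∘ suc) k))

height-count : (p : Vec Step n) (i : Fin (suc n)) →
  height p i ≡ count U (expand p) (toℕ i * 2) ⊖ count D (expand p) (toℕ i * 2)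
height-count p       zero    = refl
height-count (c ∷ p) (suc i) = begin
  rise c ℤ.+ height p i
    ≡⟨ cong (λ h → rise c ℤ.+ h) (height-count p i) ⟩
  rise c ℤ.+ (count U (expand p) (toℕ i * 2) ⊖ count D (expand p) (toℕ i * 2))
    ≡⟨ rise-⊖ c _ _ ⟩
  _
    ≡⟨ cong₂ _⊖_ (count-expand-∷ U c p (toℕ i * 2)) (count-expand-∷ D c p (toℕ i * 2)) ⟨
  count U (expand (c ∷ p)) (suc (toℕ i) * 2) ⊖ count D (expand (c ∷ p)) (suc (toℕ i) * 2) ∎
  where open ≡-Reasoning

0≤⊖⇒≥ : ∀ a b → 0ℤ ℤ.≤ a ⊖ b → b ≤ a
0≤⊖⇒≥ a b h = ℤ.drop‿+≤+ (ℤ.0≤i-j⇒j≤i (subst (0ℤ ℤ.≤_) (sym (ℤ.[+m]-[+n]≡m⊖n a b)) h))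

≥⇒0≤⊖ : ∀ a b → b ≤ a → 0ℤ ℤ.≤ a ⊖ b
≥⇒0≤⊖ a b b≤a = subst (0ℤ ℤ.≤_) (ℤ.[+m]-[+n]≡m⊖n a b) (ℤ.i≤j⇒0≤j-i (ℤ.+≤+ b≤a))

⊖≡0⇒≡ : ∀ a b → a ⊖ b ≡ 0ℤ → a ≡ b
⊖≡0⇒≡ a b eq = ℤ.+-injective (ℤ.i-j≡0⇒i≡j _ _ (trans (ℤ.[+m]-[+n]≡m⊖n a b) eq))

-- Heights settle the prefixes of even length. A prefix of odd length has one more letter `first c`,
-- which is never `D`.
motzkin⇒ballot : (p : Vec Step n) → IsMotzkinPath p → Ballot (n * 2) (expand p)
motzkin⇒ballot {n} p (nonneg , returns) = record
  { prefix = λ {k} → prefix k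
  ; total  = sym (⊖≡0⇒≡ _ _ (trans (sym end) returns))
  }
  where
  word = expand p

  end : height p (fromℕ n) ≡ count U word (n * 2) ⊖ count D word (n * 2)
  end = subst (λ l → height p (fromℕ n) ≡ count U word (l * 2) ⊖ count D word (l * 2))
              (toℕ-fromℕ n) (height-count p (fromℕ n))

  even : ∀ j → j ≤ n → count D word (j * 2) ≤ count U word (j * 2)
  even j j≤n = subst (λ l → count D word (l * 2) ≤ count U word (l * 2)) (toℕ-fromℕ< (s≤s j≤n))
    (0≤⊖⇒≥ _ _ (subst (0ℤ ℤ.≤_) (height-count p position) (nonneg position)))
    where position = fromℕ< (s≤s j≤n)

  first-indicator : ∀ c → indicator D (first c) ≡ 0
  first-indicator U = refl
  first-indicator D = refl
  first-indicator H = refl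

  prefix : ∀ k → k ≤ n * 2 → count D word k ≤ count U word k
  prefix k k≤ with half k
  ... | j , inj₁ refl = even j (*-cancelʳ-≤ j n 2 k≤)
  ... | j , inj₂ refl with *-cancelʳ-< 2 j n k≤
  ...   | j<n with expand-pairs p j j<n
  ...     | c , eq , _ rewrite eq | first-indicator c =
    ≤-trans (even j (<⇒≤ j<n)) (m≤n+m _ (indicator U (first c)))

ballot⇒motzkin : (p : Vec Step n) → Ballot (n * 2) (expand p) → IsMotzkinPath p
ballot⇒motzkin {n} p b =
  (λ i → subst (0ℤ ℤ.≤_) (sym (height-count p i))
           (≥⇒0≤⊖ _ _ (prefix (*-monoˡ-≤ 2 (s≤s⁻¹ (toℕ<n i)))))) ,
  trans (height-count p (fromℕ n)) (subst
    (λ l → count U (expand p) (l * 2) ⊖ count D (expand p) (l * 2) ≡ 0ℤ)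
    (sym (toℕ-fromℕ n))
    (trans (cong (_⊖ count D (expand p) (n * 2)) (sym total)) (ℤ.n⊖n≡0 (count D (expand p) (n * 2)))))
  where open Ballot b

-- Avoiding 4321

module _ (π : Permutation′ m) (ππ : Involutive (π ⟨$⟩ʳ_)) where

  private
    f : Fin m → Fin m
    f = π ⟨$⟩ʳ_

  -- Either the second entry of an occurrence lies strictly above the diagonal,
  -- and the arcs of the first two entries are nested, or the third lies strictly
  -- below it, and the arcs of the last two are.
  nonnesting⇒avoids : NonNesting f → Avoids π [4321]
  nonnesting⇒avoids ng (e , mono , iff) with toℕ (e 1F) <? toℕ (f (e 1F))
  ... | yes e₁<f = ng (e 0F) (e 1F) e₀<e₁ e₁<f f₁<f₀
    where
    e₀<e₁ = mono 0F 1F z<s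
    f₁<f₀ = Equivalence.to (iff 1F 0F) (s<s (s<s z<s))
  ... | no e₁≮f = ng (f (e 3F)) (f (e 2F)) f₃<f₂
                     (subst (f (e 2F) Fin.<_) (sym (ππ _)) f₂<e₂)
                     (subst₂ Fin._<_ (sym (ππ _)) (sym (ππ _)) e₂<e₃)
    where
    e₂<e₃ = mono 2F 3F (s<s (s<s z<s))
    f₃<f₂ = Equivalence.to (iff 3F 2F) z<s
    f₂<e₂ : f (e 2F) Fin.< e 2F
    f₂<e₂ = <-trans (Equivalence.to (iff 2F 1F) (s<s z<s))
                    (≤-<-trans (≮⇒≥ e₁≮f) (mono 1F 2F (s<s z<s)))

  -- The ends `i < j < f j < f i` of nested arcs form an occurrence: `f` permutes them as `[4321]`
  -- permutes their indices, so it remains that `e` preserves and reflects the order.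
  avoids⇒nonnesting : Avoids π [4321] → NonNesting f
  avoids⇒nonnesting av i j i<j j<fj fj<fi = av (e , mono , iff)
    where
    e : Fin 4 → Fin m
    e 0F = i
    e 1F = j
    e 2F = f j
    e 3F = f i

    mono : ∀ a b → a Fin.< b → e a Fin.< e b
    mono 0F 1F _ = i<j
    mono 0F 2F _ = <-trans i<j j<fj
    mono 0F 3F _ = <-trans i<j (<-trans j<fj fj<fi)
    mono 1F 2F _ = j<fj
    mono 1F 3F _ = <-trans j<fj fj<fi
    mono 2F 3F _ = fj<fi
    mono 1F 1F (s≤s ())
    mono 2F 1F (s≤s ())
    mono 2F 2F (s≤s (s≤s ()))
    mono 3F 1F (s≤s ())
    mono 3F 2F (s≤s (s≤s ()))
    mono 3F 3F (s≤s (s≤s (s≤s ())))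

    reflect : ∀ a b → e a Fin.< e b → a Fin.< b
    reflect a b ea<eb with <-cmp (toℕ a) (toℕ b)
    ... | tri< a<b _ _ = a<b
    ... | tri≈ _ a≡b _ = contradiction ea<eb (<-irrefl (cong (toℕ ∘ e) (toℕ-injective a≡b)))
    ... | tri> _ _ b<a = contradiction ea<eb (<-asym (mono b a b<a))

    f-e : ∀ a → f (e a) ≡ e ([4321] ⟨$⟩ʳ a)
    f-e 0F = refl
    f-e 1F = refl
    f-e 2F = ππ j
    f-e 3F = ππ i

    iff : ∀ a b → ([4321] ⟨$⟩ʳ a Fin.< [4321] ⟨$⟩ʳ b) ⇔ (f (e a) Fin.< f (e b))
    iff a b = mk⇔
      (λ lt → subst₂ Fin._<_ (sym (f-e a)) (sym (f-e b)) (mono _ _ lt))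
      (λ lt → reflect _ _ (subst₂ Fin._<_ (f-e a) (f-e b) lt))

-- Descents

module _ {i a b : ℕ} where

  -- For `UD` the two values lie on opposite sides of the gap between `i` and `suc i`. For `UH` and
  -- `HD` the letters give only `b ≤ a`, and `a ≢ b` makes it strict.
  paired⇒descent : ∀ c → Compares (first c) i a → Compares (second c) (suc i) b → a ≢ b → b < a
  paired⇒descent U i<a refl    a≢b = ≤∧≢⇒< i<a (a≢b ∘ sym)
  paired⇒descent H i<a (s≤s b≤i) _ = ≤-<-trans b≤i i<a
  paired⇒descent D refl (s≤s b≤i) a≢b = ≤∧≢⇒< b≤i (a≢b ∘ sym)

  -- A letter other than `U` keeps `a ≤ i`, and one other than `D` forces `i < b`. This gives the
  -- ascents between pairs and also rules out four pairs at a descent.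
  below-above⇒ascent : ∀ s t → s ≢ U → t ≢ D → Compares s i a → Compares t (suc i) b → a < b
  below-above⇒ascent s t s≢U t≢D p q = ≤-<-trans (below s s≢U p) (above t t≢D q)
    where
    below : ∀ s → s ≢ U → Compares s i a → a ≤ i
    below U U≢U _    = contradiction refl U≢U
    below D _   a<i  = <⇒≤ a<i
    below H _   refl = ≤-refl
    above : ∀ t → t ≢ D → Compares t (suc i) b → i < b
    above U _   1+i<b = <⇒≤ 1+i<b
    above D D≢D _     = contradiction refl D≢D
    above H _   refl  = ≤-refl

  -- Of the nine pairs, three are wanted and four force an ascent. The remaining `UU` and `DD` would
  -- nest two arcs at a descent, which the hypotheses exclude.
  descent⇒paired : ∀ s t → ¬ (s ≡ U × t ≡ U) → ¬ (s ≡ D × t ≡ D) →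
                   Compares s i a → Compares t (suc i) b → b < a → Paired s t
  descent⇒paired U U ¬UU _ _ _ _ = contradiction (refl , refl) ¬UU
  descent⇒paired U D _ _ _ _ _ = H , refl , refl
  descent⇒paired U H _ _ _ _ _ = U , refl , refl
  descent⇒paired H D _ _ _ _ _ = D , refl , refl
  descent⇒paired D D _ ¬DD _ _ _ = contradiction (refl , refl) ¬DD
  descent⇒paired D U _ _ p q b<a =
    contradiction b<a (<-asym (below-above⇒ascent D U (λ ()) (λ ()) p q))
  descent⇒paired D H _ _ p q b<a =
    contradiction b<a (<-asym (below-above⇒ascent D H (λ ()) (λ ()) p q))
  descent⇒paired H U _ _ p q b<a =
    contradiction b<a (<-asym (below-above⇒ascent H U (λ ()) (λ ()) p q))
  descent⇒paired H H _ _ p q b<a =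
    contradiction b<a (<-asym (below-above⇒ascent H H (λ ()) (λ ()) p q))

first≢D : ∀ c → first c ≢ D
first≢D U ()
first≢D D ()
first≢D H ()

second≢U : ∀ c → second c ≢ U
second≢U U ()
second≢U D ()
second≢U H ()

2∤odd : ∀ k → ¬ (2 ∣ suc (k * 2))
2∤odd zero    (divides (suc q) ())
2∤odd (suc k) (divides (suc q) eq) = 2∤odd k (divides q (suc-injective (suc-injective eq)))

module _ {n : ℕ} (π : Permutation′ (n * 2)) (ππ : Involutive (π ⟨$⟩ʳ_)) (w : ℕ → Step)
         (hw : HasWord w (π ⟨$⟩ʳ_)) where

  private
    f : Fin (n * 2) → Fin (n * 2)
    f = π ⟨$⟩ʳ_

  alternating⇒pairs : NonNesting f → IsReverseAlternating π → Pairs n w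
  alternating⇒pairs ng alt k k<n = subst₂ (λ a b → Paired (w a) (w b)) p≡ q≡
    (descent⇒paired (w (toℕ p)) (w (toℕ q)) ¬UU ¬DD (hw p)
      (subst (λ l → Compares (w (toℕ q)) l (toℕ (f q))) q≡1+p (hw q)) fq<fp)
    where
    odd< : suc (k * 2) < n * 2
    odd< = *-monoˡ-≤ 2 k<n
    -- Counted from 0 the pair starts at an even index, which is an odd position of the one-line
    -- notation and hence a descent.
    p = fromℕ< (<⇒≤ odd<)
    q = fromℕ< odd<
    p≡ : toℕ p ≡ k * 2
    p≡ = toℕ-fromℕ< (<⇒≤ odd<)
    q≡ : toℕ q ≡ suc (k * 2)
    q≡ = toℕ-fromℕ< odd<
    q≡1+p : toℕ q ≡ suc (toℕ p)
    q≡1+p = trans q≡ (cong suc (sym p≡))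
    p<q : p Fin.< q
    p<q = ≤-reflexive (sym q≡1+p)
    fq<fp : f q Fin.< f p
    fq<fp = Equivalence.from (alt p q q≡1+p)
      (subst (λ l → ¬ (2 ∣ suc l)) (sym p≡) (2∤odd k))
    -- Two openers would give `p < q < f q < f p`.
    ¬UU : ¬ (w (toℕ p) ≡ U × w (toℕ q) ≡ U)
    ¬UU (_ , wq) = ng p q p<q (compareAt w hw q wq) fq<fp
    -- Two closers would give `f q < f p < p < q`.
    ¬DD : ¬ (w (toℕ p) ≡ D × w (toℕ q) ≡ D)
    ¬DD (wp , _) = ng (f q) (f p) fq<fp
      (subst (f p Fin.<_) (sym (ππ p)) (compareAt w hw p wp))
      (subst₂ Fin._<_ (sym (ππ p)) (sym (ππ q)) p<q)

  pairs⇒alternating : Pairs n w → IsReverseAlternating π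
  pairs⇒alternating ps i j j≡1+i with half (toℕ i)
  ... | k , inj₁ i≡ = mk⇔
        (λ _ → subst (λ l → ¬ (2 ∣ suc l)) (sym i≡) (2∤odd k)) (λ _ → descent)
    where
    descent : f j Fin.< f i
    descent with ps k (*-cancelʳ-< 2 k n (subst (_< n * 2) i≡ (toℕ<n i)))
    ... | c , eq₁ , eq₂ = paired⇒descent c
      (compareAt w hw i (trans (cong w i≡) eq₁))
      (subst (λ l → Compares (second c) l (toℕ (f j))) j≡1+i
        (compareAt w hw j (trans (cong w (trans j≡1+i (cong suc i≡))) eq₂)))
      (λ fi≡fj → <⇒≢ (≤-reflexive (sym j≡1+i)) (cong toℕ
        (trans (sym (ππ i)) (trans (cong f (toℕ-injective fi≡fj)) (ππ j)))))
  -- Here `i` ends one pair and `j` starts the next: their letters are `second c`, never `U`, and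
  -- `first d`, never `D`.
  ... | k , inj₂ i≡ = mk⇔
        (λ fj<fi → contradiction fj<fi (<-asym ascent))
        (λ odd → contradiction (divides (suc k) (cong suc i≡)) odd)
    where
    ascent : f i Fin.< f j
    ascent with ps k (*-cancelʳ-< 2 k n (<-trans ≤-refl (subst (_< n * 2) i≡ (toℕ<n i))))
              | ps (suc k) (*-cancelʳ-< 2 (suc k) n
                  (subst (_< n * 2) (trans j≡1+i (cong suc i≡)) (toℕ<n j)))
    ... | c , _ , eq₂ | d , eq₁ , _ = below-above⇒ascent (second c) (first d)
      (second≢U c) (first≢D d)
      (compareAt w hw i (trans (cong w i≡) eq₂))
      (subst (λ l → Compares (first d) l (toℕ (f j))) j≡1+i
        (compareAt w hw j (trans (cong w (trans j≡1+i (cong suc i≡))) eq₁)))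

-- The bijection

MotzkinPath-setoid : ℕ → Setoid 0ℓ 0ℓ
MotzkinPath-setoid n = record
  { Carrier       = Σ[ p ∈ Vec Step n ] IsMotzkinPath p
  ; _≈_           = λ p q → proj₁ p ≡ proj₁ q
  ; isEquivalence = record { refl = refl ; sym = sym ; trans = trans }
  }

module _ (n : ℕ) (x : RAI (n * 2) [4321]) where

  private
    f : Fin (n * 2) → Fin (n * 2)
    f = perm x ⟨$⟩ʳ_

  rai-involutive : Involutive f
  rai-involutive i = trans (cong f (isInvolution x i)) (inverseʳ (perm x))

  rai-nonnesting : NonNesting f
  rai-nonnesting = avoids⇒nonnesting (perm x) rai-involutive (avoids x)

  rai-pairs : Pairs n (wordOf f)
  rai-pairs = alternating⇒pairs (perm x) rai-involutive (wordOf f) (wordOf-hasWord f)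
                rai-nonnesting (isReverseAlternating x)

  rai-path : Vec Step n
  rai-path = compress n (wordOf f)

  rai-agree : AgreeBelow (n * 2) (wordOf f) (expand rai-path)
  rai-agree = expand-compress n rai-pairs

  rai-path-hasWord : HasWord (expand rai-path) f
  rai-path-hasWord = hasWord-agree rai-agree (wordOf-hasWord f)

  rai-motzkin : IsMotzkinPath rai-path
  rai-motzkin = ballot⇒motzkin rai-path
    (ballot-cong rai-agree (wordOf-ballot (perm x) rai-involutive))

module _ {n : ℕ} (p : Vec Step n) (mp : IsMotzkinPath p) where

  open FromBallot (motzkin⇒ballot p mp)

  path-rai : RAI (n * 2) [4321]
  path-rai = record
    { perm                 = matching
    ; isReverseAlternating =
        pairs⇒alternating matching match-involutive (expand p) match-hasWord (expand-pairs p)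
    -- `matching` has `match` as both of its directions, so it equals its inverse by computation.
    ; isInvolution         = λ _ → refl
    ; avoids               = nonnesting⇒avoids matching match-involutive match-nonnesting
    }

  rai-path-rai : rai-path n path-rai ≡ p
  rai-path-rai = trans (compress-cong n (hasWord-wordOf match-hasWord)) (compress-expand p)

rai-path-cong : ∀ n (x y : RAI (n * 2) [4321]) →
                (∀ i → perm x ⟨$⟩ʳ i ≡ perm y ⟨$⟩ʳ i) → rai-path n x ≡ rai-path n y
rai-path-cong n x y x≈y = compress-cong n (agreeBelow (λ i → begin
  wordOf (perm x ⟨$⟩ʳ_) (toℕ i)              ≡⟨ wordOf-toℕ (perm x ⟨$⟩ʳ_) i ⟩
  letter (toℕ i) (toℕ (perm x ⟨$⟩ʳ i))       ≡⟨ cong (letter (toℕ i) ∘ toℕ) (x≈y i) ⟩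
  letter (toℕ i) (toℕ (perm y ⟨$⟩ʳ i))       ≡⟨ wordOf-toℕ (perm y ⟨$⟩ʳ_) i ⟨
  wordOf (perm y ⟨$⟩ʳ_) (toℕ i)              ∎))
  where open ≡-Reasoning

-- Equal paths expand to one word shared by both involutions, and a nonnesting involution is
-- determined by its word.
rai-path-injective : ∀ n (x y : RAI (n * 2) [4321]) → rai-path n x ≡ rai-path n y →
                     ∀ i → perm x ⟨$⟩ʳ i ≡ perm y ⟨$⟩ʳ i
rai-path-injective n x y eq = nonnesting-unique {w = expand (rai-path n x)}
  (rai-involutive n x) (rai-involutive n y) (rai-nonnesting n x) (rai-nonnesting n y)
  (rai-path-hasWord n x)
  (subst (λ p → HasWord (expand p) (perm y ⟨$⟩ʳ_)) (sym eq) (rai-path-hasWord n y))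

RAI-MotzkinPath : ∀ n → Inverse (RAI-setoid (n * 2) [4321]) (MotzkinPath-setoid n)
RAI-MotzkinPath n = Bijection⇒Inverse (record
  { to        = λ x → rai-path n x , rai-motzkin n x
  ; cong      = λ {x} {y} → rai-path-cong n x y
  ; bijective = (λ {x} {y} → rai-path-injective n x y) ,
      λ (p , mp) → path-rai p mp ,
        λ {z} z≈ → trans (rai-path-cong n z (path-rai p mp) z≈) (rai-path-rai p mp)
  })

-- Enumeration of Motzkin paths

lookup-injective : ∀ {a} {A : Set a} {xs : List A} → Unique xs →
                   ∀ i j → List.lookup xs i ≡ List.lookup xs j → i ≡ j
lookup-injective (_ ∷ _)   zero    zero    _  = refl
lookup-injective (x∉ ∷ _)  zero    (suc j) eq = contradiction eq (All.lookup x∉ (∈-lookup j))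
lookup-injective (x∉ ∷ _)  (suc i) zero    eq = contradiction (sym eq) (All.lookup x∉ (∈-lookup i))
lookup-injective (_ ∷ xs!) (suc i) (suc j) eq = cong suc (lookup-injective xs! i j eq)

∈-steps : ∀ s → s ∈ U ∷ D ∷ H ∷ []
∈-steps U = here refl
∈-steps D = there (here refl)
∈-steps H = there (there (here refl))

∈-words : (p : Vec Step n) → p ∈ words n
∈-words []      = here refl
∈-words (s ∷ p) = ∈-cartesianProductWith⁺ _∷_ (∈-steps s) (∈-words p)

words-unique : ∀ n → Unique (words n)
words-unique zero    = [] ∷ []
words-unique (suc n) = Unique.cartesianProductWith⁺ _∷_ Vec.∷-injective
  (((λ ()) ∷ (λ ()) ∷ []) ∷ ((λ ()) ∷ []) ∷ [] ∷ []) (words-unique n)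

MotzkinPath-cardinality : ∀ n → HasCardinality (MotzkinPath-setoid n) (motzkin n)
MotzkinPath-cardinality n = record
  { to        = index
  ; from      = λ i → List.lookup paths i , proj₂ (∈-filter⁻ isMotzkinPath? {xs = words n} (∈-lookup i))
  ; to-cong   = λ {p} {q} p≡q → lookup-index-unique p (index q) (trans p≡q (lookup-path q))
  ; from-cong = cong (List.lookup paths)
  ; inverse   = (λ {i} {p} p≡ → lookup-index-unique p i p≡) ,
                (λ { {p} refl → sym (lookup-path p) })
  }
  where
  paths = List.filter isMotzkinPath? (words n)

  member : (p : Setoid.Carrier (MotzkinPath-setoid n)) → proj₁ p ∈ paths
  member (p , mp) = ∈-filter⁺ isMotzkinPath? (∈-words p) mp

  index : Setoid.Carrier (MotzkinPath-setoid n) → Fin (motzkin n)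
  index p = Any.index (member p)

  lookup-path : ∀ p → proj₁ p ≡ List.lookup paths (index p)
  lookup-path p = lookup-index (member p)

  -- As `paths` has no repetitions, the index depends on the path alone and not on the membership
  -- proof that produced it.
  lookup-index-unique : ∀ p i → proj₁ p ≡ List.lookup paths i → index p ≡ i
  lookup-index-unique p i eq =
    lookup-injective (Unique.filter⁺ isMotzkinPath? (words-unique n)) (index p) i
      (trans (sym (lookup-path p)) eq)

theorem5p2 : (n : ℕ) → HasCardinality (RAI-setoid (2 * n) [4321]) (motzkin n)
-- The bijection lives at length `n * 2`, because `suc n * 2` unfolds to two successors, that is, to
-- one more pair of letters.
theorem5p2 n = subst (λ m → HasCardinality (RAI-setoid m [4321]) (motzkin n)) (*-comm n 2)
  (RAI-MotzkinPath n ∘ᵢ MotzkinPath-cardinality n)
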